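{- Let $A,B,C$ be complex vector spaces of dimension $3$ with bases $a_0,a_1,a_2$, $b_0,b_1,b_2$, $c_0,c_1,c_2$, and let $$T_{skewcw,2}=\sum_{j=1}^2\left(a_0\otimes b_j\otimes c_j+a_j\otimes b_0\otimes c_j\right)+\left(a_1\otimes b_2-a_2\otimes b_1\right)\otimes c_0.$$ Then $\mathbf{R}(T_{skewcw,2}^{\boxtimes 2})\le 18$.
   Context: The rank $\mathbf{R}(T)$ of a tensor $T$ is the smallest $r$ such that $T$ is a sum of $r$ tensors of the form $a\otimes b\otimes c$. The Kronecker square $T^{\boxtimes 2}$ is $T\otimes T$ regarded as a 3-way tensor in $(A\otimes A)\otimes(B\otimes B)\otimes(C\otimes C)$. -}

module Defs where

open import Level using (Level; _⊔_) renaming (suc to lsuc)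
open import Data.Nat using (ℕ; zero; suc)
open import Data.Fin using (Fin; zero; suc)
open import Data.Vec using (Vec; []; _∷_)
open import Data.Product using (Σ; _×_; _,_; ∃)
open import Algebra.Bundles using (CommutativeRing)
open import Relation.Nullary using (¬_)

module RingHelpers {c ℓ : Level} (R : CommutativeRing c ℓ) where
  open CommutativeRing R using (Carrier; 0#; 1#; _+_; _*_)
  ι : ℕ → Carrier
  ι zero = 0#
  ι (suc n) = 1# + ι n
  -- value at x of the monic polynomial x^n + c_{n-1} x^{n-1} + ... + c_0,
  -- where the vector lists c_{n-1}, ..., c_0 (Horner scheme, acc starts at 1)
  monicEval : ∀ {n} → Vec Carrier n → Carrier → Carrier → Carrier
  monicEval [] x acc = acc
  monicEval (a ∷ as) x acc = monicEval as x (acc * x + a)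

-- An algebraically closed field of characteristic zero (stand-in for ℂ).
record ACF0 (c ℓ : Level) : Set (lsuc (c ⊔ ℓ)) where
  field
    commRing : CommutativeRing c ℓ
  open CommutativeRing commRing using (Carrier; _≈_; 0#; 1#; _*_)
  open RingHelpers commRing
  field
    0≉1     : ¬ (0# ≈ 1#)
    inverse : ∀ x → ¬ (x ≈ 0#) → Σ Carrier λ y → x * y ≈ 1#
    algClosed : ∀ n (cs : Vec Carrier (suc n)) → Σ Carrier λ x → monicEval cs x 1# ≈ 0#
    char0   : ∀ n → ¬ (ι (suc n) ≈ 0#)

module _ {c ℓ : Level} (K : ACF0 c ℓ) where
  open ACF0 K
  open CommutativeRing commRing using (Carrier; _≈_; 0#; 1#; _+_; _*_; -_)

  sumFin : (r : ℕ) → (Fin r → Carrier) → Carrier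
  sumFin zero f = 0#
  sumFin (suc r) f = f zero + sumFin r (λ i → f (suc i))

  Tensor : Set → Set → Set → Set c
  Tensor I J L = I → J → L → Carrier

  RankLE : ∀ {I J L : Set} → ℕ → Tensor I J L → Set (c ⊔ ℓ)
  RankLE {I} {J} {L} r T =
    Σ (Fin r → I → Carrier) λ a →
    Σ (Fin r → J → Carrier) λ b →
    Σ (Fin r → L → Carrier) λ w →
      ∀ i j k → T i j k ≈ sumFin r (λ l → a l i * b l j * w l k)

  kron2 : ∀ {I J L : Set} → Tensor I J L → Tensor (I × I) (J × J) (L × L)
  kron2 T (i , i′) (j , j′) (k , k′) = T i j k * T i′ j′ k′

  Tskewcw2 : Tensor (Fin 3) (Fin 3) (Fin 3)
  Tskewcw2 zero (suc zero) (suc zero) = 1#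
  Tskewcw2 zero (suc (suc zero)) (suc (suc zero)) = 1#
  Tskewcw2 (suc zero) zero (suc zero) = 1#
  Tskewcw2 (suc (suc zero)) zero (suc (suc zero)) = 1#
  Tskewcw2 (suc zero) (suc (suc zero)) zero = 1#
  Tskewcw2 (suc (suc zero)) (suc zero) zero = - 1#
  Tskewcw2 _ _ _ = 0#

-- Negating b₀ and the c-vector indexed 2, and replacing k by -k mod 3, turns
-- T_skewcw,2 into the Levi-Civita tensor ε, so its Kronecker square is the
-- polarised 3 × 3 determinant.  With ω a primitive cube root of unity,
--   Σ_{p,q} (ω^(Q + p(i+j+k) + q(i'+j'+k')) - ω^(-Q + p(i+j+k) + q(i'+j'+k'))),
-- where Q = ii' + jj' + kk' and p, q range over ℤ/3, is 9 (ω² - ω) ε_ijk ε_i'j'k':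
-- the sums over p and q leave only the triples with i + j + k = i' + j' + k' = 0,
-- i.e. those that are constant or permutations.  If one of them is constant then
-- Q = 0 and the two terms cancel; otherwise Q = -1 or 1 according to whether the
-- permutations have the same parity or not.  The scalar is inverted through
-- (ω² - ω)(1 + 2ω) = 3.
module Submission where

open import Level using (Level)
open import Defs

open import Algebra.Bundles using (CommutativeRing)
import Algebra.Properties.AbelianGroup as AbelianGroupProperties
import Algebra.Properties.Semiring.Mult as SemiringMult
import Algebra.Solver.Ring.NaturalCoefficients.Default as SemiringSolver
open import Data.Fin using (Fin; zero; suc; toℕ; remQuot)
open import Data.Fin.Properties using (all?)
open import Data.Nat as ℕ using (ℕ; zero; suc)
open import Data.Product using (_×_; _,_; proj₁; proj₂)
open import Data.Vec using ([]; _∷_)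
open import Data.Vec.Functional using (foldr)
open import Function using (_∘_)
open import Relation.Binary.PropositionalEquality using (_≡_; cong)
import Relation.Binary.Reasoning.Setoid as SetoidReasoning
open import Relation.Nullary.Decidable using (Dec; from-yes; _×-dec_)

-- Arithmetic of ℤ[ω] with natural coefficients

-- The triple ⟨ a , b , c ⟩ stands for a + bω + cω², so that -1 = ω + ω² needs
-- no subtraction.
record ℕ[ω] : Set where
  constructor ⟨_,_,_⟩
  field
    c₀ c₁ c₂ : ℕ

infixl 6 _⊕_
infixl 7 _⊗_
infix 4 _≋_ _≋?_

_⊕_ : ℕ[ω] → ℕ[ω] → ℕ[ω]
⟨ a , b , c ⟩ ⊕ ⟨ d , e , f ⟩ = ⟨ a ℕ.+ d , b ℕ.+ e , c ℕ.+ f ⟩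

-- Cyclic convolution: exponents of ω are reduced by ω³ = 1 alone, and the relation 1 + ω + ω² = 0
-- is left to `_≋_`.
_⊗_ : ℕ[ω] → ℕ[ω] → ℕ[ω]
⟨ a , b , c ⟩ ⊗ ⟨ d , e , f ⟩ =
  ⟨ a ℕ.* d ℕ.+ (b ℕ.* f ℕ.+ c ℕ.* e)
  , a ℕ.* e ℕ.+ b ℕ.* d ℕ.+ c ℕ.* f
  , a ℕ.* f ℕ.+ b ℕ.* e ℕ.+ c ℕ.* d ⟩

-- Equality modulo 1 + ω + ω².
_≋_ : ℕ[ω] → ℕ[ω] → Set
⟨ a , b , c ⟩ ≋ ⟨ d , e , f ⟩ = (a ℕ.+ e ≡ d ℕ.+ b) × (a ℕ.+ f ≡ d ℕ.+ c)

_≋?_ : ∀ x y → Dec (x ≋ y)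
⟨ a , b , c ⟩ ≋? ⟨ d , e , f ⟩ = (a ℕ.+ e ℕ.≟ d ℕ.+ b) ×-dec (a ℕ.+ f ℕ.≟ d ℕ.+ c)

𝟘 𝟙 -𝟙 : ℕ[ω]
𝟘  = ⟨ 0 , 0 , 0 ⟩
𝟙  = ⟨ 1 , 0 , 0 ⟩
-𝟙 = ⟨ 0 , 1 , 1 ⟩

ω^_ : ℕ → ℕ[ω]
ω^ 0 = 𝟙
ω^ 1 = ⟨ 0 , 1 , 0 ⟩
ω^ 2 = ⟨ 0 , 0 , 1 ⟩
ω^ suc (suc (suc n)) = ω^ n

∑ : ∀ {n} → (Fin n → ℕ[ω]) → ℕ[ω]
∑ = foldr _⊕_ 𝟘

-- The tensor and its eighteen summands over ℕ[ω]

skewcw : Fin 3 → Fin 3 → Fin 3 → ℕ[ω]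
skewcw zero (suc zero) (suc zero) = 𝟙
skewcw zero (suc (suc zero)) (suc (suc zero)) = 𝟙
skewcw (suc zero) zero (suc zero) = 𝟙
skewcw (suc (suc zero)) zero (suc (suc zero)) = 𝟙
skewcw (suc zero) (suc (suc zero)) zero = 𝟙
skewcw (suc (suc zero)) (suc zero) zero = -𝟙
skewcw _ _ _ = 𝟘

signB signC : Fin 3 → ℕ[ω]
signB zero = -𝟙
signB _    = 𝟙
signC (suc (suc zero)) = -𝟙
signC _                = 𝟙

-- The index of a summand encodes the sign ± of Q together with (p , q); the sign
-- enters the exponent as a factor 1 or 2 ≡ -1 mod 3, and u = 2 does the same for
-- the replacement of k by -k.
summand : Fin 18 → Fin 2 × Fin 3 × Fin 3
summand l = let (e , pq) = remQuot {2} 9 l in e , remQuot {3} 3 pq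

exponent : Fin 2 × Fin 3 × Fin 3 → (u : ℕ) → Fin 3 × Fin 3 → ℕ
exponent (e , p , q) u (i , i′) =
  -- `u` scales only the linear part: negating both k and k' leaves kk' unchanged.
  suc (toℕ e) ℕ.* (toℕ i ℕ.* toℕ i′) ℕ.+ u ℕ.* (toℕ p ℕ.* toℕ i ℕ.+ toℕ q ℕ.* toℕ i′)

-- Q and both linear forms are sums over the three index pairs, so each power of ω splits into three
-- factors and every summand has rank at most one.
factorA factorB factorC : Fin 18 → Fin 3 × Fin 3 → ℕ[ω]
factorA l i = ω^ exponent (summand l) 1 i
factorB l j = signB (proj₁ j) ⊗ signB (proj₂ j) ⊗ ω^ exponent (summand l) 1 j
factorC l k =
  sign (proj₁ (summand l)) ⊗ signC (proj₁ k) ⊗ signC (proj₂ k) ⊗ ω^ exponent (summand l) 2 k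
  where
  sign : Fin 2 → ℕ[ω]
  -- The multiplier 1 + 2ω turns the scalar 9 (ω² - ω) into the integer 27.
  sign zero    = ⟨ 1 , 2 , 0 ⟩
  sign (suc _) = -𝟙 ⊗ ⟨ 1 , 2 , 0 ⟩

decomposition : ∀ i i′ j j′ k k′ →
  ⟨ 27 , 0 , 0 ⟩ ⊗ (skewcw i j k ⊗ skewcw i′ j′ k′)
    ≋ ∑ (λ l → factorA l (i , i′) ⊗ factorB l (j , j′) ⊗ factorC l (k , k′))
-- `_≋_` is decidable, so evaluating all 3⁶ = 729 entries proves the identity.
decomposition = from-yes
  (all? λ i → all? λ i′ → all? λ j → all? λ j′ → all? λ k → all? λ k′ →
    ⟨ 27 , 0 , 0 ⟩ ⊗ (skewcw i j k ⊗ skewcw i′ j′ k′)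
      ≋? ∑ (λ l → factorA l (i , i′) ⊗ factorB l (j , j′) ⊗ factorC l (k , k′)))

-- Evaluation at a root of 1 + x + x² in a commutative ring

module Evaluation {c ℓ : Level} (R : CommutativeRing c ℓ) where
  open CommutativeRing R
  open SemiringMult semiring using (×-homo-+; ×1-homo-*) renaming (_×_ to _·_)
  open AbelianGroupProperties +-abelianGroup using (∙-cancelʳ; inverseˡ-unique)
  open SemiringSolver commutativeSemiring
  open SetoidReasoning setoid

  module At (ω : Carrier) (1+ω+ω²≈0 : 1# + (ω + ω * ω) ≈ 0#) where

    -- Adding ω + ω² makes both sides vanish: the left becomes ω (1 + ω + ω²).
    ω³≈1 : ω * ω * ω ≈ 1#
    ω³≈1 = ∙-cancelʳ (ω + ω * ω) _ _ (begin
      ω * ω * ω + (ω + ω * ω)  ≈⟨ solve 1 (λ ω → ω :* ω :* ω :+ (ω :+ ω :* ω) :=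
                                    ω :* (con 1 :+ (ω :+ ω :* ω))) refl ω ⟩
      ω * (1# + (ω + ω * ω))   ≈⟨ *-congˡ 1+ω+ω²≈0 ⟩
      ω * 0#                   ≈⟨ zeroʳ ω ⟩
      0#                       ≈⟨ 1+ω+ω²≈0 ⟨
      1# + (ω + ω * ω)         ∎)

    eval : ℕ[ω] → Carrier
    eval ⟨ a , b , c ⟩ = a · 1# + (b · 1# * ω + c · 1# * (ω * ω))

    eval-⊕ : ∀ x y → eval (x ⊕ y) ≈ eval x + eval y
    eval-⊕ ⟨ a , b , c ⟩ ⟨ d , e , f ⟩ = begin
      eval (⟨ a , b , c ⟩ ⊕ ⟨ d , e , f ⟩)
        ≈⟨ +-cong (×-homo-+ 1# a d)
             (+-cong (*-congʳ (×-homo-+ 1# b e)) (*-congʳ (×-homo-+ 1# c f))) ⟩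
      (a · 1# + d · 1#) + ((b · 1# + e · 1#) * ω + (c · 1# + f · 1#) * (ω * ω))
        ≈⟨ solve 7 (λ a b c d e f ω →
             (a :+ d) :+ ((b :+ e) :* ω :+ (c :+ f) :* (ω :* ω)) :=
             (a :+ (b :* ω :+ c :* (ω :* ω))) :+ (d :+ (e :* ω :+ f :* (ω :* ω))))
             refl (a · 1#) (b · 1#) (c · 1#) (d · 1#) (e · 1#) (f · 1#) ω ⟩
      eval ⟨ a , b , c ⟩ + eval ⟨ d , e , f ⟩ ∎

    ·1-homo-+* : ∀ m n p q → (m ℕ.* n ℕ.+ p ℕ.* q) · 1# ≈ m · 1# * n · 1# + p · 1# * q · 1#
    ·1-homo-+* m n p q =
      trans (×-homo-+ 1# (m ℕ.* n) (p ℕ.* q)) (+-cong (×1-homo-* m n) (×1-homo-* p q))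

    eval-⊗ : ∀ x y → eval (x ⊗ y) ≈ eval x * eval y
    eval-⊗ ⟨ a , b , c ⟩ ⟨ d , e , f ⟩ = begin
      eval (⟨ a , b , c ⟩ ⊗ ⟨ d , e , f ⟩)
        ≈⟨ +-cong
             (trans (×-homo-+ 1# (a ℕ.* d) _) (+-cong (×1-homo-* a d) (·1-homo-+* b f c e)))
             (+-cong
               (*-congʳ (trans (×-homo-+ 1# (a ℕ.* e ℕ.+ b ℕ.* d) (c ℕ.* f))
                 (+-cong (·1-homo-+* a e b d) (×1-homo-* c f))))
               (*-congʳ (trans (×-homo-+ 1# (a ℕ.* f ℕ.+ b ℕ.* e) (c ℕ.* d))
                 (+-cong (·1-homo-+* a f b e) (×1-homo-* c d))))) ⟩
      (A * D + (B * F + C * E)) + ((A * E + B * D + C * F) * ω + (A * F + B * E + C * D) * (ω * ω))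
        -- The products that wrapped around in the convolution get their ω³ back; what remains is a
        -- polynomial identity in ω.
        ≈⟨ +-cong (+-congˡ (times-ω³ (B * F + C * E)))
             (+-congʳ (*-congʳ (+-congˡ (times-ω³ (C * F))))) ⟩
      (A * D + (B * F + C * E) * (ω * ω * ω))
        + ((A * E + B * D + C * F * (ω * ω * ω)) * ω + (A * F + B * E + C * D) * (ω * ω))
        ≈⟨ solve 7 (λ a b c d e f ω →
             (a :* d :+ (b :* f :+ c :* e) :* (ω :* ω :* ω))
               :+ ((a :* e :+ b :* d :+ c :* f :* (ω :* ω :* ω)) :* ω
                 :+ (a :* f :+ b :* e :+ c :* d) :* (ω :* ω)) :=
             (a :+ (b :* ω :+ c :* (ω :* ω))) :* (d :+ (e :* ω :+ f :* (ω :* ω))))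
             refl A B C D E F ω ⟩
      eval ⟨ a , b , c ⟩ * eval ⟨ d , e , f ⟩ ∎
      where
      A = a · 1#
      B = b · 1#
      C = c · 1#
      D = d · 1#
      E = e · 1#
      F = f · 1#

      times-ω³ : ∀ x → x ≈ x * (ω * ω * ω)
      times-ω³ x = sym (trans (*-congˡ ω³≈1) (*-identityʳ x))

    vanish : ∀ x y → x + y * (1# + (ω + ω * ω)) ≈ x
    vanish x y = trans (+-congˡ (trans (*-congˡ 1+ω+ω²≈0) (zeroʳ y))) (+-identityʳ x)

    -- Add d (1 + ω + ω²) on the left and a (1 + ω + ω²) on the right. Both constant terms become a
    -- + d, and the two hypotheses equate the coefficients of ω and ω².
    eval-≋ : ∀ x y → x ≋ y → eval x ≈ eval y
    eval-≋ ⟨ a , b , c ⟩ ⟨ d , e , f ⟩ (a+e≡d+b , a+f≡d+c) = begin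
      eval ⟨ a , b , c ⟩
        ≈⟨ vanish _ (d · 1#) ⟨
      eval ⟨ a , b , c ⟩ + d · 1# * (1# + (ω + ω * ω))
        ≈⟨ regroup (a · 1#) (b · 1#) (c · 1#) (d · 1#) ⟩
      (a · 1# + d · 1#) + ((d · 1# + b · 1#) * ω + (d · 1# + c · 1#) * (ω * ω))
        ≈⟨ +-cong (+-comm _ _) (+-cong (*-congʳ (swap d b a e a+e≡d+b)) (*-congʳ (swap d c a f a+f≡d+c))) ⟩
      (d · 1# + a · 1#) + ((a · 1# + e · 1#) * ω + (a · 1# + f · 1#) * (ω * ω))
        ≈⟨ regroup (d · 1#) (e · 1#) (f · 1#) (a · 1#) ⟨
      eval ⟨ d , e , f ⟩ + a · 1# * (1# + (ω + ω * ω))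
        ≈⟨ vanish _ (a · 1#) ⟩
      eval ⟨ d , e , f ⟩ ∎
      where
      regroup : ∀ x y z t → (x + (y * ω + z * (ω * ω))) + t * (1# + (ω + ω * ω))
                          ≈ (x + t) + ((t + y) * ω + (t + z) * (ω * ω))
      regroup x y z t = solve 5 (λ x y z t ω →
        (x :+ (y :* ω :+ z :* (ω :* ω))) :+ t :* (con 1 :+ (ω :+ ω :* ω)) :=
        (x :+ t) :+ ((t :+ y) :* ω :+ (t :+ z) :* (ω :* ω))) refl x y z t ω

      swap : ∀ m n p q → p ℕ.+ q ≡ m ℕ.+ n → m · 1# + n · 1# ≈ p · 1# + q · 1#
      swap m n p q eq = begin
        m · 1# + n · 1#  ≈⟨ ×-homo-+ 1# m n ⟨
        (m ℕ.+ n) · 1#   ≡⟨ cong (_· 1#) eq ⟨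
        (p ℕ.+ q) · 1#   ≈⟨ ×-homo-+ 1# p q ⟩
        p · 1# + q · 1#  ∎

    eval-ℕ : ∀ n → eval ⟨ n , 0 , 0 ⟩ ≈ n · 1#
    eval-ℕ n = trans (+-congˡ (trans (+-cong (zeroˡ ω) (zeroˡ (ω * ω))) (+-identityʳ 0#)))
                     (+-identityʳ (n · 1#))

    eval-𝟘 : eval 𝟘 ≈ 0#
    eval-𝟘 = eval-ℕ 0

    eval-𝟙 : eval 𝟙 ≈ 1#
    eval-𝟙 = trans (eval-ℕ 1) (+-identityʳ 1#)

    eval--𝟙 : eval -𝟙 ≈ - 1#
    eval--𝟙 = begin
      eval -𝟙    ≈⟨ solve 1 (λ ω →
                      con 0 :+ ((con 1 :+ con 0) :* ω :+ (con 1 :+ con 0) :* (ω :* ω)) :=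
                      ω :+ ω :* ω) refl ω ⟩
      ω + ω * ω  ≈⟨ inverseˡ-unique _ _ (trans (+-comm _ _) 1+ω+ω²≈0) ⟩
      - 1#       ∎

-- The decomposition over the field

module Transfer {c ℓ : Level} (K : ACF0 c ℓ) where
  open ACF0 K
  open CommutativeRing commRing hiding (zero)
  open Evaluation commRing
  open SemiringSolver commutativeSemiring
  open SetoidReasoning setoid

  ω : Carrier
  -- The vector lists the lower coefficients of x² + x + 1; the argument 1 is the degree minus one.
  ω = proj₁ (algClosed 1 (1# ∷ 1# ∷ []))

  1+ω+ω²≈0 : 1# + (ω + ω * ω) ≈ 0#
  1+ω+ω²≈0 = trans
    -- The right-hand side is the Horner form to which `monicEval` unfolds.
    (solve 1 (λ ω → con 1 :+ (ω :+ ω :* ω) := (con 1 :* ω :+ con 1) :* ω :+ con 1) refl ω)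
    (proj₂ (algClosed 1 (1# ∷ 1# ∷ [])))

  open At ω 1+ω+ω²≈0

  sumFin-cong : ∀ n {f g : Fin n → Carrier} → (∀ l → f l ≈ g l) → sumFin K n f ≈ sumFin K n g
  sumFin-cong zero    f≈g = refl
  sumFin-cong (suc n) f≈g = +-cong (f≈g zero) (sumFin-cong n (f≈g ∘ suc))

  *-distribˡ-sumFin : ∀ n x (f : Fin n → Carrier) → x * sumFin K n f ≈ sumFin K n (λ l → x * f l)
  *-distribˡ-sumFin zero    x f = zeroʳ x
  *-distribˡ-sumFin (suc n) x f =
    trans (distribˡ x _ _) (+-congˡ (*-distribˡ-sumFin n x (f ∘ suc)))

  eval-∑ : ∀ n (f : Fin n → ℕ[ω]) → eval (∑ f) ≈ sumFin K n (eval ∘ f)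
  eval-∑ zero    f = eval-𝟘
  eval-∑ (suc n) f = trans (eval-⊕ (f zero) (∑ (f ∘ suc))) (+-congˡ (eval-∑ n (f ∘ suc)))

  eval-skewcw : ∀ i j k → eval (skewcw i j k) ≈ Tskewcw2 K i j k
  eval-skewcw zero zero _ = eval-𝟘
  eval-skewcw zero (suc zero) zero = eval-𝟘
  eval-skewcw zero (suc zero) (suc zero) = eval-𝟙
  eval-skewcw zero (suc zero) (suc (suc zero)) = eval-𝟘
  eval-skewcw zero (suc (suc zero)) zero = eval-𝟘
  eval-skewcw zero (suc (suc zero)) (suc zero) = eval-𝟘
  eval-skewcw zero (suc (suc zero)) (suc (suc zero)) = eval-𝟙
  eval-skewcw (suc zero) zero zero = eval-𝟘
  eval-skewcw (suc zero) zero (suc zero) = eval-𝟙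
  eval-skewcw (suc zero) zero (suc (suc zero)) = eval-𝟘
  eval-skewcw (suc zero) (suc zero) _ = eval-𝟘
  eval-skewcw (suc zero) (suc (suc zero)) zero = eval-𝟙
  eval-skewcw (suc zero) (suc (suc zero)) (suc _) = eval-𝟘
  eval-skewcw (suc (suc zero)) zero zero = eval-𝟘
  eval-skewcw (suc (suc zero)) zero (suc zero) = eval-𝟘
  eval-skewcw (suc (suc zero)) zero (suc (suc zero)) = eval-𝟙
  eval-skewcw (suc (suc zero)) (suc zero) zero = eval--𝟙
  eval-skewcw (suc (suc zero)) (suc zero) (suc _) = eval-𝟘
  eval-skewcw (suc (suc zero)) (suc (suc zero)) _ = eval-𝟘

  27⁻¹ : Carrier
  -- `char0 26` speaks of `ι 27`, which unfolds to the same sum of ones as `27 · 1#`.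
  27⁻¹ = proj₁ (inverse _ (char0 26))

  27⁻¹*27≈1 : 27⁻¹ * eval ⟨ 27 , 0 , 0 ⟩ ≈ 1#
  27⁻¹*27≈1 = begin
    27⁻¹ * eval ⟨ 27 , 0 , 0 ⟩  ≈⟨ *-congˡ (eval-ℕ 27) ⟩
    27⁻¹ * _                    ≈⟨ *-comm _ _ ⟩
    _ * 27⁻¹                    ≈⟨ proj₂ (inverse _ (char0 26)) ⟩
    1#                          ∎

  a b w : Fin 18 → Fin 3 × Fin 3 → Carrier
  a l i = eval (factorA l i)
  b l j = eval (factorB l j)
  w l k = 27⁻¹ * eval (factorC l k)

  -- Inserting 1 = 27⁻¹ * 27 brings in the identity over ℕ[ω]; the factor 27⁻¹ is then distributed
  -- over the sum and absorbed into each `w l`.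
  decomposition-K : ∀ i j k → kron2 K (Tskewcw2 K) i j k ≈ sumFin K 18 (λ l → a l i * b l j * w l k)
  decomposition-K (i , i′) (j , j′) (k , k′) = begin
    Tskewcw2 K i j k * Tskewcw2 K i′ j′ k′
      ≈⟨ *-cong (eval-skewcw i j k) (eval-skewcw i′ j′ k′) ⟨
    eval (skewcw i j k) * eval (skewcw i′ j′ k′)
      ≈⟨ eval-⊗ (skewcw i j k) (skewcw i′ j′ k′) ⟨
    eval TT
      ≈⟨ *-identityˡ _ ⟨
    1# * eval TT
      ≈⟨ *-congʳ 27⁻¹*27≈1 ⟨
    27⁻¹ * eval ⟨ 27 , 0 , 0 ⟩ * eval TT
      ≈⟨ *-assoc _ _ _ ⟩
    27⁻¹ * (eval ⟨ 27 , 0 , 0 ⟩ * eval TT)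
      ≈⟨ *-congˡ (eval-⊗ ⟨ 27 , 0 , 0 ⟩ TT) ⟨
    27⁻¹ * eval (⟨ 27 , 0 , 0 ⟩ ⊗ TT)
      ≈⟨ *-congˡ (eval-≋ (⟨ 27 , 0 , 0 ⟩ ⊗ TT) (∑ term) (decomposition i i′ j j′ k k′)) ⟩
    27⁻¹ * eval (∑ term)
      ≈⟨ *-congˡ (eval-∑ 18 term) ⟩
    27⁻¹ * sumFin K 18 (eval ∘ term)
      ≈⟨ *-distribˡ-sumFin 18 27⁻¹ (eval ∘ term) ⟩
    sumFin K 18 (λ l → 27⁻¹ * eval (term l))
      ≈⟨ sumFin-cong 18 eval-term ⟩
    sumFin K 18 (λ l → a l (i , i′) * b l (j , j′) * w l (k , k′)) ∎
    where
    TT : ℕ[ω]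
    TT = skewcw i j k ⊗ skewcw i′ j′ k′

    term : Fin 18 → ℕ[ω]
    term l = factorA l (i , i′) ⊗ factorB l (j , j′) ⊗ factorC l (k , k′)

    eval-term : ∀ l → 27⁻¹ * eval (term l) ≈ a l (i , i′) * b l (j , j′) * w l (k , k′)
    eval-term l = begin
      27⁻¹ * eval (x ⊗ y ⊗ z)               ≈⟨ *-congˡ (eval-⊗ (x ⊗ y) z) ⟩
      27⁻¹ * (eval (x ⊗ y) * eval z)        ≈⟨ *-congˡ (*-congʳ (eval-⊗ x y)) ⟩
      27⁻¹ * (eval x * eval y * eval z)     ≈⟨ solve 4 (λ r x y z →
                                                 r :* (x :* y :* z) := x :* y :* (r :* z))
                                                 refl 27⁻¹ (eval x) (eval y) (eval z) ⟩
      eval x * eval y * (27⁻¹ * eval z)     ∎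
      where
      x = factorA l (i , i′)
      y = factorB l (j , j′)
      z = factorC l (k , k′)

theorem2p9 : ∀ {c ℓ : Level} (K : ACF0 c ℓ) → RankLE K 18 (kron2 K (Tskewcw2 K))
theorem2p9 K = a , b , w , decomposition-K
  where open Transfer K
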